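{- Let $(M;c)$ be a connected, modular coloured matroid with no rainbow triangle. If $r(M)\ge2$ and $|c|\ge3$, then $(M;c)$ has a nonempty decomposer.
   Context: A coloured matroid $(M;c)$ is a (finite) matroid $M$ with a function $c$ on $E(M)$; $|c|$ is the number of colours used. $M$ is modular if $r_M(F)+r_M(F')=r_M(F\cup F')+r_M(F\cap F')$ for all flats $F,F'$. A rainbow triangle is a three-element circuit on which $c$ is injective. A decomposer of $(M;c)$ is a proper flat $F$ of $M$ such that for every $e\in E(M)-F$, the set $\mathrm{cl}_M(F\cup\{e\})-F$ is monochromatic under $c$. -}

module Defs where

open import Data.Nat using (ℕ; _≤_; _<_)
open import Data.Nat.Properties using (_≟_)
open import Data.Fin using (Fin)
import Data.Fin.Properties as FinP
open import Data.Fin.Subset using (Subset; _∪_; _∩_; _⊆_; ∣_∣; ⁅_⁆; _∈_; _∉_; _-_; ⊤)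
open import Data.Vec using (tabulate)
open import Data.Product using (Σ; ∃; _×_)
open import Data.Fin.Base using (Fin)
open import Relation.Binary.PropositionalEquality using (_≡_; _≢_)
open import Relation.Nullary using (¬_; does)
open import Relation.Nullary.Decidable using (⌊_⌋)
open import Data.Fin.Properties using (any?)

-- A matroid on the ground set E = Fin n, given by its rank function
-- (standard rank axioms R1–R3, Oxley §1.3).
record Matroid (n : ℕ) : Set where
  field
    r       : Subset n → ℕ
    r-bound : ∀ X → r X ≤ ∣ X ∣
    r-mono  : ∀ {X Y} → X ⊆ Y → r X ≤ r Y
    r-sub   : ∀ X Y → r (X ∪ Y) Data.Nat.+ r (X ∩ Y) ≤ r X Data.Nat.+ r Y

module _ {n : ℕ} (M : Matroid n) where
  open Matroid M

  rank : ℕ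
  rank = r ⊤

  cl : Subset n → Subset n
  cl X = tabulate (λ e → ⌊ r (X ∪ ⁅ e ⁆) ≟ r X ⌋)

  IsFlat : Subset n → Set
  IsFlat F = cl F ≡ F

  Independent : Subset n → Set
  Independent X = r X ≡ ∣ X ∣

  IsCircuit : Subset n → Set
  IsCircuit C = ¬ Independent C × (∀ e → e ∈ C → Independent (C - e))

  IsModular : Set
  IsModular = ∀ F F' → IsFlat F → IsFlat F' →
    r F Data.Nat.+ r F' ≡ r (F ∪ F') Data.Nat.+ r (F ∩ F')

  -- connected (Oxley §4.1): every two distinct elements lie in a common circuit
  IsConnected : Set
  IsConnected = ∀ e f → e ≢ f → ∃ λ C → IsCircuit C × e ∈ C × f ∈ C

  module _ {k : ℕ} (c : Fin n → Fin k) where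

    InjectiveOn : Subset n → Set
    InjectiveOn X = ∀ x y → x ∈ X → y ∈ X → c x ≡ c y → x ≡ y

    IsRainbowTriangle : Subset n → Set
    IsRainbowTriangle C = IsCircuit C × ∣ C ∣ ≡ 3 × InjectiveOn C

    NoRainbowTriangle : Set
    NoRainbowTriangle = ∀ C → ¬ IsRainbowTriangle C

    usedColours : Subset k
    usedColours = tabulate (λ j → ⌊ any? (λ e → c e FinP.≟ j) ⌋)

    numColours : ℕ
    numColours = ∣ usedColours ∣

    Monochromatic : Subset n → Set
    Monochromatic X = ∀ x y → x ∈ X → y ∈ X → c x ≡ c y

    IsDecomposer : Subset n → Set
    IsDecomposer F = IsFlat F × F ≢ ⊤ ×
      (∀ e → e ∉ F → Monochromatic (cl (F ∪ ⁅ e ⁆) Data.Fin.Subset.─ F))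

{-# OPTIONS --safe #-}
module Submission where

-- If some colour class does not span M, its closure F is a decomposer: two elements a, b ∉ F of
-- cl(F ∪ e) span a line meeting F, and the points q ∈ F all of whose lines are monochromatic off F
-- form a flat containing the class.
--
-- Otherwise merge the colours into three spanning classes and look for a contradiction.  Call (H, F)
-- a layer if F ⊊ H are flats and H ─ F is monochromatic, of colour β say; every layer can be
-- enlarged.  Enlarging H by a point of colour α and by one of colour γ must give different covers of
-- H.  A line through such points u, v has a third point w, of colour α after exchanging α and γ if
-- necessary.  Let T be spanned by the points of H ─ F on lines through two γ-points of cl(H ∪ v) ─ H,
-- together with the γ-points of F.  Lines through T preserve the set of α-points of cl(H ∪ u) ─ H.
-- So if T = H, then (cl(H ∪ u), H) is a larger layer.  If T ≠ H, then the γ-points of cl(H ∪ v) ─ H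
-- all lie in cl(F ∪ v) or all in cl(T ∪ v), and the layer grows to cl(H ∪ v).
--
-- That T preserves α-points rests on a plane configuration excluded by counting.  Finiteness is
-- essential there: by Monsky, a valuation on an infinite field three-colours the projective plane
-- with all classes spanning and no rainbow line.

open import Defs
open import Data.Nat using (ℕ; zero; suc; _+_; _≤_; _<_; z≤n; s≤s; s≤s⁻¹; _≤?_)
open import Data.Nat.Properties as ℕₚ using (≤-refl; ≤-reflexive; ≤-trans; ≤-antisym; +-mono-≤;
  +-monoˡ-≤; +-monoʳ-≤; +-cancelʳ-≤; +-cancelˡ-≤; +-comm; +-suc; ≰⇒>; ≤∧≢⇒<; <⇒≱; m≤m+n;
  module ≤-Reasoning)
open import Data.Fin as Fin using (Fin; zero; suc)
import Data.Fin.Properties as Finₚ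
open import Data.Fin.Subset using (Subset; Nonempty; _∪_; _∩_; _⊆_; _⊂_; ∣_∣; ⁅_⁆; _∈_; _∉_; _-_;
  _─_; ⊤; ⋃) renaming (⊥ to ∅)
open import Data.Fin.Subset.Properties using (_∈?_; x∈p∪q⁻; x∈p∩q⁺; x∈p∩q⁻; p⊆p∪q; q⊆p∪q; ⊆-refl;
  ⊆-antisym; x∈⁅x⁆; x∈⁅y⁆⇒x≡y; ∣⁅x⁆∣≡1; ∣⊤∣≡n; ∣⊥∣≡0; ∈⊤; ⊥⊆; p─q⊆p; p─⊥≡p; p─x─y≡p─y─x;
  x∈p∧x≢y⇒x∈p-y; x∈p⇒∣p-x∣<∣p∣; p⊂q⇒∣p∣<∣q∣; nonempty?; Empty-unique; ∣p∣≤n; ∣p∣≤∣x∷p∣)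
open import Data.Vec using (tabulate; []; _∷_; here; there)
open import Data.Vec.Properties using ([]=⇒lookup; lookup⇒[]=; lookup∘tabulate)
open import Data.Bool using (true; false)
open import Data.List using (List; []; _∷_; map; filter; allFin)
open import Data.List.Membership.Propositional using () renaming (_∈_ to _∈ˡ_)
open import Data.List.Membership.Propositional.Properties using (∈-filter⁺; ∈-filter⁻; ∈-allFin)
open import Data.List.Relation.Unary.Any using (here; there)
open import Data.Product using (Σ; ∃; _×_; _,_; proj₁; proj₂)
open import Data.Sum using (_⊎_; inj₁; inj₂; [_,_]′)
open import Data.Empty using (⊥; ⊥-elim)
open import Function using (_∘_)
open import Relation.Binary.PropositionalEquality using (_≡_; _≢_; refl; sym; trans; cong; subst;
  ≢-sym)
open import Relation.Nullary using (¬_; Dec; yes; no; contradiction)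
open import Relation.Nullary.Decidable using (⌊_⌋; _×-dec_; _⊎-dec_; ¬?; _→-dec_; toWitness;
  decidable-stable)

-- Subsets from decidable predicates and from lists

module _ {n : ℕ} {P : Fin n → Set} (P? : ∀ x → Dec (P x)) where

  ∈-tabulate⁺ : ∀ {x} → P x → x ∈ tabulate (λ y → ⌊ P? y ⌋)
  ∈-tabulate⁺ {x} px = lookup⇒[]= x _ (trans (lookup∘tabulate _ x) eq)
    where
    eq : ⌊ P? x ⌋ ≡ true
    eq with P? x
    ... | yes _ = refl
    ... | no ¬px = contradiction px ¬px

  ∈-tabulate⁻ : ∀ {x} → x ∈ tabulate (λ y → ⌊ P? y ⌋) → P x
  ∈-tabulate⁻ {x} x∈ with P? x | trans (sym (lookup∘tabulate (λ y → ⌊ P? y ⌋) x)) ([]=⇒lookup x∈)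
  ... | yes px | _ = px
  ... | no _   | ()

module _ {n : ℕ} where

  ∪-least : {p q s : Subset n} → p ⊆ s → q ⊆ s → p ∪ q ⊆ s
  ∪-least {p} {q} p⊆s q⊆s x∈ = [ p⊆s , q⊆s ]′ (x∈p∪q⁻ p q x∈)

  ∪ˡ : {p q : Subset n} → p ⊆ p ∪ q
  ∪ˡ {_} {q} = p⊆p∪q q

  ∪ʳ : {p q : Subset n} → q ⊆ p ∪ q
  ∪ʳ {p} {q} = q⊆p∪q p q

  ⁅⁆⊆ : ∀ {x} {p : Subset n} → x ∈ p → ⁅ x ⁆ ⊆ p
  ⁅⁆⊆ {x} {p} x∈p y∈ = subst (_∈ p) (sym (x∈⁅y⁆⇒x≡y x y∈)) x∈p

  ⟨_⟩ : List (Fin n) → Subset n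
  ⟨ xs ⟩ = ⋃ (map ⁅_⁆ xs)

  elements : Subset n → List (Fin n)
  elements p = filter (_∈? p) (allFin n)

  ∈⟨⟩⁺ : ∀ {x xs} → x ∈ˡ xs → x ∈ ⟨ xs ⟩
  ∈⟨⟩⁺ {x} (here refl) = ∪ˡ (x∈⁅x⁆ x)
  ∈⟨⟩⁺ {xs = y ∷ _} (there x∈xs) = ∪ʳ {⁅ y ⁆} (∈⟨⟩⁺ x∈xs)

  ⊆⟨elements⟩ : ∀ {p} → p ⊆ ⟨ elements p ⟩
  ⊆⟨elements⟩ {p} {x} x∈p = ∈⟨⟩⁺ (∈-filter⁺ (_∈? p) (∈-allFin x) x∈p)

  elements⁻ : ∀ {p x} → x ∈ˡ elements p → x ∈ p
  elements⁻ {p} x∈ = proj₂ (∈-filter⁻ (_∈? p) {xs = allFin n} x∈)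

-- Closure, parallelism and lines in an arbitrary matroid

module Closure {n : ℕ} (M : Matroid n) where
  open Matroid M

  ⟪_⟫ : Subset n → Subset n
  ⟪_⟫ = cl M

  submodular : ∀ {W Z X Y} → W ⊆ X ∪ Y → Z ⊆ X → Z ⊆ Y → r W + r Z ≤ r X + r Y
  submodular W⊆ Z⊆X Z⊆Y =
    ≤-trans (+-mono-≤ (r-mono W⊆) (r-mono λ z → x∈p∩q⁺ (Z⊆X z , Z⊆Y z))) (r-sub _ _)

  r-⁅⁆≤1 : ∀ x → r ⁅ x ⁆ ≤ 1
  r-⁅⁆≤1 x = ≤-trans (r-bound ⁅ x ⁆) (≤-reflexive (∣⁅x⁆∣≡1 x))

  r-∪⁅⁆ : ∀ X x → r (X ∪ ⁅ x ⁆) ≤ r X + 1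
  r-∪⁅⁆ X x = ≤-trans (m≤m+n _ _)
    (≤-trans (submodular ⊆-refl ⊥⊆ ⊥⊆) (+-monoʳ-≤ (r X) (r-⁅⁆≤1 x)))

  ∈cl⁺ : ∀ {X e} → r (X ∪ ⁅ e ⁆) ≤ r X → e ∈ ⟪ X ⟫
  ∈cl⁺ {X} p = ∈-tabulate⁺ (λ e → r (X ∪ ⁅ e ⁆) ℕₚ.≟ r X) (≤-antisym p (r-mono ∪ˡ))

  ∈cl⁻ : ∀ {X e} → e ∈ ⟪ X ⟫ → r (X ∪ ⁅ e ⁆) ≤ r X
  ∈cl⁻ {X} e∈ = ≤-reflexive (∈-tabulate⁻ (λ e → r (X ∪ ⁅ e ⁆) ℕₚ.≟ r X) e∈)

  cl-extensive : ∀ {X} → X ⊆ ⟪ X ⟫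
  cl-extensive e∈X = ∈cl⁺ (r-mono (∪-least ⊆-refl (⁅⁆⊆ e∈X)))

  -- Induction on the list: `X ∪ ⟨ xs ⟩` and `X ∪ ⁅ x ⁆` both contain `X`, so by submodularity one
  -- more point of the closure adds no rank.
  r-absorbs : ∀ {X} xs → (∀ {x} → x ∈ˡ xs → x ∈ ⟪ X ⟫) → r (X ∪ ⟨ xs ⟩) ≤ r X
  r-absorbs [] _ = r-mono (∪-least ⊆-refl ⊥⊆)
  r-absorbs {X} (x ∷ xs) h = +-cancelʳ-≤ (r X) _ _
    (≤-trans (submodular {X = X ∪ ⟨ xs ⟩} {Y = X ∪ ⁅ x ⁆}
               (∪-least (∪ˡ ∘ ∪ˡ) (∪-least (∪ʳ ∘ ∪ʳ) (∪ˡ ∘ ∪ʳ))) ∪ˡ ∪ˡ)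
             (+-mono-≤ (r-absorbs xs (h ∘ there)) (∈cl⁻ (h (here refl)))))

  r-≤ : ∀ {X Y} → Y ⊆ ⟪ X ⟫ → r Y ≤ r X
  r-≤ {X} {Y} Y⊆ = ≤-trans (r-mono (∪ʳ ∘ ⊆⟨elements⟩)) (r-absorbs {X} (elements Y) (Y⊆ ∘ elements⁻))

  cl-mono : ∀ {X Y} → X ⊆ Y → ⟪ X ⟫ ⊆ ⟪ Y ⟫
  cl-mono {X} {Y} X⊆Y {e} e∈ = ∈cl⁺ (+-cancelʳ-≤ (r X) _ _
    (≤-trans (submodular {X = Y} {Y = X ∪ ⁅ e ⁆} (∪-least ∪ˡ (∪ʳ ∘ ∪ʳ)) X⊆Y ∪ˡ)
             (+-monoʳ-≤ (r Y) (∈cl⁻ e∈))))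

  cl-flat : ∀ {X} → IsFlat M ⟪ X ⟫
  cl-flat {X} = ⊆-antisym
    (λ e∈ → ∈cl⁺ (≤-trans (r-≤ (∪-least (cl-extensive ∘ cl-extensive) (⁅⁆⊆ e∈))) (r-≤ ⊆-refl)))
    cl-extensive

  cl-least : ∀ {X F} → IsFlat M F → X ⊆ F → ⟪ X ⟫ ⊆ F
  cl-least {X} flat X⊆F e∈ = subst (_ ∈_) flat (cl-mono X⊆F e∈)

  cover : Subset n → Fin n → Subset n
  cover H a = ⟪ H ∪ ⁅ a ⁆ ⟫

  line : Fin n → Fin n → Subset n
  line x y = ⟪ ⁅ x ⁆ ∪ ⁅ y ⁆ ⟫

  ⊆cover : ∀ {H a} → H ⊆ cover H a
  ⊆cover = cl-extensive ∘ ∪ˡ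

  ∈cover : ∀ {H a} → a ∈ cover H a
  ∈cover {H} {a} = cl-extensive (∪ʳ {p = H} (x∈⁅x⁆ a))

  cover-least : ∀ {H a G} → IsFlat M G → H ⊆ G → a ∈ G → cover H a ⊆ G
  cover-least flat H⊆G a∈G = cl-least flat (∪-least H⊆G (⁅⁆⊆ a∈G))

  line-least : ∀ {x y G} → IsFlat M G → x ∈ G → y ∈ G → line x y ⊆ G
  line-least flat x∈G = cover-least flat (⁅⁆⊆ x∈G)

  ∈line₁ : ∀ {x y} → x ∈ line x y
  ∈line₁ {x} = ⊆cover (x∈⁅x⁆ x)

  ∈line₂ : ∀ {x y} → y ∈ line x y
  ∈line₂ = ∈cover

  -- Adding `x` raises the rank of the flat `H`, and the whole cover has rank at most `r H + 1`, so
  -- `x` already spans it.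
  exchange : ∀ {H a x} → IsFlat M H → x ∈ cover H a → x ∉ H → a ∈ cover H x
  exchange {H} {a} {x} flat x∈ x∉ = ∈cl⁺ (≤-trans (r-≤ H∪x∪a⊆)
    (≤-trans (r-∪⁅⁆ H a) (≤-trans (≤-reflexive (+-comm (r H) 1)) r<)))
    where
    H∪x∪a⊆ : (H ∪ ⁅ x ⁆) ∪ ⁅ a ⁆ ⊆ ⟪ H ∪ ⁅ a ⁆ ⟫
    H∪x∪a⊆ = ∪-least (∪-least ⊆cover (⁅⁆⊆ x∈)) (⁅⁆⊆ ∈cover)
    r< : r H < r (H ∪ ⁅ x ⁆)
    r< = ≰⇒> λ p → x∉ (subst (x ∈_) flat (∈cl⁺ p))

  infix 4 _∥_ _∦_

  -- The matroid need not be simple: points of the geometry are classes of `∥`, an equivalence once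
  -- loops are excluded.
  _∥_ _∦_ : Fin n → Fin n → Set
  x ∥ y = r (⁅ x ⁆ ∪ ⁅ y ⁆) ≤ 1
  x ∦ y = ¬ x ∥ y

  _∥?_ : ∀ x y → Dec (x ∥ y)
  x ∥? y = r (⁅ x ⁆ ∪ ⁅ y ⁆) ≤? 1

  ∥-refl : ∀ {x} → x ∥ x
  ∥-refl {x} = ≤-trans (r-mono (∪-least ⊆-refl ⊆-refl)) (r-⁅⁆≤1 x)

  ∥-sym : ∀ {x y} → x ∥ y → y ∥ x
  ∥-sym = ≤-trans (r-mono (∪-least ∪ʳ ∪ˡ))

  line-exchange : ∀ {x y u v} → u ∈ line x y → v ∈ line x y → u ∦ v → line x y ⊆ line u v
  line-exchange {x} {y} {u} {v} u∈ v∈ u∦v {e} e∈ = ∈cl⁺ (≤-trans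
    (r-≤ (∪-least (∪-least (⁅⁆⊆ u∈) (⁅⁆⊆ v∈)) (⁅⁆⊆ e∈)))
    (≤-trans (r-∪⁅⁆ ⁅ x ⁆ y) (≤-trans (+-monoˡ-≤ 1 (r-⁅⁆≤1 x)) (≰⇒> u∦v))))

  -- Three-element circuits, written as three distinct points of a line.
  Triangle : Fin n → Fin n → Fin n → Set
  Triangle x y z = x ∦ y × y ∦ z × x ∦ z × z ∈ line x y

  triangle? : ∀ x y z → Dec (Triangle x y z)
  triangle? x y z = ¬? (x ∥? y) ×-dec ¬? (y ∥? z) ×-dec ¬? (x ∥? z) ×-dec (z ∈? line x y)

  swap : ∀ {x y z} → Triangle x y z → Triangle y x z
  swap (x∦y , y∦z , x∦z , z∈) =
    x∦y ∘ ∥-sym , x∦z , y∦z , cl-mono (∪-least ∪ʳ ∪ˡ) z∈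

  rotate : ∀ {x y z} → Triangle x y z → Triangle y z x
  rotate (x∦y , y∦z , x∦z , z∈) =
    y∦z , x∦z ∘ ∥-sym , x∦y ∘ ∥-sym , line-exchange ∈line₂ z∈ y∦z ∈line₁

  flip : ∀ {x y z} → Triangle x y z → Triangle x z y
  flip = rotate ∘ swap

  triangle-∈ : ∀ {x y z G} → IsFlat M G → Triangle x y z → x ∈ G → y ∈ G → z ∈ G
  triangle-∈ flat (_ , _ , _ , z∈) x∈G y∈G = line-least flat x∈G y∈G z∈

module _ {n : ℕ} where

  ⊆-reinsert : ∀ {p : Subset n} {x} → p ⊆ (p - x) ∪ ⁅ x ⁆
  ⊆-reinsert {p} {x} {y} y∈p with y Finₚ.≟ x
  ... | yes refl = ∪ʳ {p = p - x} (x∈⁅x⁆ x)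
  ... | no y≢x   = ∪ˡ (x∈p∧x≢y⇒x∈p-y y∈p y≢x)

∣p∣≡1+∣p-x∣ : ∀ {n} {p : Subset n} {x} → x ∈ p → ∣ p ∣ ≡ suc ∣ p - x ∣
∣p∣≡1+∣p-x∣ {p = _ ∷ p} here = cong (suc ∘ ∣_∣) (sym (p─⊥≡p p))
∣p∣≡1+∣p-x∣ {p = true ∷ p} (there x∈p) = cong suc (∣p∣≡1+∣p-x∣ x∈p)
∣p∣≡1+∣p-x∣ {p = false ∷ p} (there x∈p) = ∣p∣≡1+∣p-x∣ x∈p

∃≢ : ∀ {n} → 2 ≤ n → (x : Fin n) → ∃ λ y → x ≢ y
∃≢ (s≤s (s≤s _)) zero    = suc zero , λ ()
∃≢ (s≤s (s≤s _)) (suc _) = zero , λ ()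

-- The projective geometry of a connected modular matroid

module Projective {n : ℕ} (M : Matroid n)
  (connected : IsConnected M) (modular : IsModular M) (2≤rank : 2 ≤ rank M) where
  open Matroid M
  open Closure M

  inhabited : ∀ {p} → 1 ≤ r p → Nonempty p
  inhabited {p} 1≤ with nonempty? p
  ... | yes ne = ne
  ... | no ¬ne = contradiction
    (≤-trans 1≤ (≤-trans (r-bound p) (≤-reflexive (trans (cong ∣_∣ (Empty-unique ¬ne)) (∣⊥∣≡0 n)))))
    λ ()

  -- For a circuit `C` through `x` and another element `y`, the set `C - y` is independent and
  -- contains `x`. If `x` had rank zero, deleting it would cost an element but no rank.
  loopless : ∀ x → 1 ≤ r ⁅ x ⁆
  loopless x = ≰⇒> λ rx≤0 →
    let y , x≢y = ∃≢ (≤-trans 2≤rank (≤-trans (r-bound ⊤) (≤-reflexive (∣⊤∣≡n n)))) x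
        C , (_ , indep) , x∈C , y∈C = connected x y x≢y
        D = C - y
        x∈D = x∈p∧x≢y⇒x∈p-y x∈C x≢y
    in <⇒≱ (x∈p⇒∣p-x∣<∣p∣ x∈D) (begin
      ∣ D ∣                 ≡⟨ sym (indep y y∈C) ⟩
      r D                   ≤⟨ m≤m+n _ _ ⟩
      r D + r ∅             ≤⟨ submodular ⊆-reinsert ⊥⊆ ⊥⊆ ⟩
      r (D - x) + r ⁅ x ⁆   ≤⟨ +-mono-≤ (r-bound (D - x)) rx≤0 ⟩
      ∣ D - x ∣ + 0         ≡⟨ ℕₚ.+-identityʳ _ ⟩
      ∣ D - x ∣             ∎)
    where open ≤-Reasoning

  ∉cl∅ : ∀ {z} → z ∉ ⟪ ∅ ⟫
  ∉cl∅ {z} z∈ = <⇒≱ (loopless z) (begin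
    r ⁅ z ⁆         ≤⟨ r-mono (∪ʳ {p = ∅}) ⟩
    r (∅ ∪ ⁅ z ⁆)   ≤⟨ ∈cl⁻ {∅} z∈ ⟩
    r ∅             ≤⟨ r-bound ∅ ⟩
    ∣ ∅ {n} ∣       ≡⟨ ∣⊥∣≡0 n ⟩
    0               ∎)
    where open ≤-Reasoning

  -- Submodularity for `G` and the rank-one pair, which share the non-loop `x`.
  ∥-closed : ∀ {x y G} → IsFlat M G → x ∈ G → x ∥ y → y ∈ G
  ∥-closed {x} {y} {G} flat x∈G x∥y = subst (y ∈_) flat (∈cl⁺ (+-cancelʳ-≤ 1 _ _ (begin
    r (G ∪ ⁅ y ⁆) + 1        ≤⟨ +-monoʳ-≤ _ (loopless x) ⟩
    r (G ∪ ⁅ y ⁆) + r ⁅ x ⁆  ≤⟨ submodular (∪-least ∪ˡ (∪ʳ ∘ ∪ʳ)) (⁅⁆⊆ x∈G) ∪ˡ ⟩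
    r G + r (⁅ x ⁆ ∪ ⁅ y ⁆)  ≤⟨ +-monoʳ-≤ (r G) x∥y ⟩
    r G + 1                  ∎)))
    where open ≤-Reasoning

  point : Fin n → Subset n
  point x = ⟪ ⁅ x ⁆ ⟫

  ∈point : ∀ {x} → x ∈ point x
  ∈point {x} = cl-extensive (x∈⁅x⁆ x)

  ∈point⁻ : ∀ {x y} → y ∈ point x → x ∥ y
  ∈point⁻ {x} y∈ = ≤-trans (∈cl⁻ y∈) (r-⁅⁆≤1 x)

  ∥-trans : ∀ {x y z} → x ∥ y → y ∥ z → x ∥ z
  ∥-trans x∥y y∥z = ∈point⁻ (∥-closed cl-flat (∥-closed cl-flat ∈point x∥y) y∥z)

  triangle-∥ : ∀ {x x′ y z} → x ∥ x′ → Triangle x y z → Triangle x′ y z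
  triangle-∥ x∥x′ (x∦y , y∦z , x∦z , z∈) =
    x∦y ∘ ∥-trans x∥x′ , y∦z , x∦z ∘ ∥-trans x∥x′ ,
    line-least cl-flat (∥-closed cl-flat ∈line₁ (∥-sym x∥x′)) ∈line₂ z∈

  flats-meet : ∀ {F G} → IsFlat M F → IsFlat M G → r (F ∪ G) < r F + r G → Nonempty (F ∩ G)
  flats-meet {F} {G} flatF flatG r< = inhabited (+-cancelˡ-≤ (r (F ∪ G)) _ _
    (≤-trans (≤-reflexive (+-comm (r (F ∪ G)) 1))
      (≤-trans r< (≤-reflexive (modular F G flatF flatG)))))

  2≤r-line : ∀ {x y} → x ∦ y → 2 ≤ r (line x y)
  2≤r-line x∦y = ≤-trans (≰⇒> x∦y) (r-mono cl-extensive)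

  abstract

    -- `H` is a hyperplane of `cover H a`, so by modularity a line in that cover has too much rank
    -- to miss it.
    meet : ∀ {H a x y} → IsFlat M H → x ∈ cover H a → y ∈ cover H a → x ∉ H → y ∉ H → x ∦ y →
      ∃ λ h → h ∈ H × Triangle x y h
    meet {H} {a} {x} {y} flat x∈ y∈ x∉H y∉H x∦y =
      let h , h∈D∩H = flats-meet cl-flat flat r<
          h∈D , h∈H = x∈p∩q⁻ (line x y) H h∈D∩H
      in h , h∈H , x∦y ,
         (λ y∥h → y∉H (∥-closed flat h∈H (∥-sym y∥h))) ,
         (λ x∥h → x∉H (∥-closed flat h∈H (∥-sym x∥h))) , h∈D
      where
      open ≤-Reasoning
      r< : r (line x y ∪ H) < r (line x y) + r H
      r< = begin-strict
        r (line x y ∪ H)    ≤⟨ r-≤ (∪-least (line-least cl-flat x∈ y∈) ⊆cover) ⟩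
        r (H ∪ ⁅ a ⁆)       ≤⟨ r-∪⁅⁆ H a ⟩
        r H + 1             ≡⟨ +-comm (r H) 1 ⟩
        1 + r H             <⟨ +-monoˡ-≤ (r H) (2≤r-line x∦y) ⟩
        r (line x y) + r H  ∎

    -- In a circuit C through x and y, the flats spanned by {x , y} and by C - x - y meet.
    third : ∀ {x y} → x ∦ y → ∃ λ z → Triangle x y z
    third {x} {y} x∦y = on-circuit (connected x y λ { refl → x∦y ∥-refl })
      where
      open ≤-Reasoning
      on-circuit : (∃ λ C → IsCircuit M C × x ∈ C × y ∈ C) → ∃ λ z → Triangle x y z
      on-circuit (C , (dep , indep) , x∈C , y∈C) =
        let q , q∈D∩G = flats-meet cl-flat cl-flat r<
            q∈D , q∈G = x∈p∩q⁻ (line x y) ⟪ C - x - y ⟫ q∈D∩G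
        in q , x∦y , (λ y∥q → y∉G (∥-closed cl-flat q∈G (∥-sym y∥q))) ,
                     (λ x∥q → x∉G (∥-closed cl-flat q∈G (∥-sym x∥q))) , q∈D
        where
        y∈C-x : y ∈ C - x
        y∈C-x = x∈p∧x≢y⇒x∈p-y y∈C λ { refl → x∦y ∥-refl }
        smaller : ∣ C - x - y ∣ < r (C - x)
        smaller = ≤-trans (x∈p⇒∣p-x∣<∣p∣ y∈C-x) (≤-reflexive (sym (indep x x∈C)))
        r-C-x≡r-C-y : r (C - x) ≡ r (C - y)
        r-C-x≡r-C-y = trans (indep x x∈C) (trans
          (ℕₚ.suc-injective (trans (sym (∣p∣≡1+∣p-x∣ x∈C)) (∣p∣≡1+∣p-x∣ y∈C))) (sym (indep y y∈C)))
        y∉G : y ∉ ⟪ C - x - y ⟫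
        y∉G y∈G = <⇒≱ smaller (≤-trans
          (r-≤ (∪-least cl-extensive (⁅⁆⊆ y∈G) ∘ ⊆-reinsert)) (r-bound (C - x - y)))
        x∉G : x ∉ ⟪ C - x - y ⟫
        x∉G x∈G = <⇒≱ smaller (≤-trans (≤-reflexive r-C-x≡r-C-y) (≤-trans
          (r-≤ (∪-least (cl-extensive ∘ subst (_ ∈_) (p─x─y≡p─y─x C y x)) (⁅⁆⊆ x∈G) ∘ ⊆-reinsert))
          (r-bound (C - x - y))))
        rC≤ : r C ≤ r (C - x)
        rC≤ = ≤-trans (s≤s⁻¹ (≤-trans (≤∧≢⇒< (r-bound C) dep) (≤-reflexive (∣p∣≡1+∣p-x∣ x∈C))))
          (≤-reflexive (sym (indep x x∈C)))
        r< : r (line x y ∪ ⟪ C - x - y ⟫) < r (line x y) + r ⟪ C - x - y ⟫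
        r< = begin-strict
          r (line x y ∪ ⟪ C - x - y ⟫)
            ≤⟨ r-≤ (∪-least (line-least cl-flat (cl-extensive x∈C) (cl-extensive y∈C))
                            (cl-mono (p─q⊆p C ⁅ x ⁆ ∘ p─q⊆p (C - x) ⁅ y ⁆))) ⟩
          r C                            ≤⟨ rC≤ ⟩
          r (C - x)                      ≤⟨ r-mono ⊆-reinsert ⟩
          r ((C - x - y) ∪ ⁅ y ⁆)        ≤⟨ r-∪⁅⁆ (C - x - y) y ⟩
          r (C - x - y) + 1              ≤⟨ +-monoˡ-≤ 1 (r-mono cl-extensive) ⟩
          r ⟪ C - x - y ⟫ + 1            ≡⟨ +-comm (r ⟪ C - x - y ⟫) 1 ⟩
          1 + r ⟪ C - x - y ⟫            <⟨ +-monoˡ-≤ (r ⟪ C - x - y ⟫) (2≤r-line x∦y) ⟩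
          r (line x y) + r ⟪ C - x - y ⟫ ∎

  module _ (S : Fin n → Set) (S-∥ : ∀ {x y} → S x → x ∥ y → S y)
    (S-triangle : ∀ {x y z} → S x → S y → Triangle x y z → S z) where

    -- Flats are built by joining points. After adding a generator `x` to the flat `H`, a new point
    -- `z` is parallel to `x` or on a line from `x` to a point of `H`, so `S` reaches it.
    cl-⟨⟩⊆ : ∀ xs → (∀ {x} → x ∈ˡ xs → S x) → ∀ {z} → z ∈ ⟪ ⟨ xs ⟩ ⟫ → S z
    cl-⟨⟩⊆ [] _ z∈ = ⊥-elim (∉cl∅ z∈)
    cl-⟨⟩⊆ (x ∷ xs) Sxs {z} z∈ = go (z ∈? H) (x ∈? H) (x ∥? z)
      where
      H = ⟪ ⟨ xs ⟩ ⟫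
      z∈cover : z ∈ cover H x
      z∈cover = cl-mono {⟨ x ∷ xs ⟩} {H ∪ ⁅ x ⁆} (∪-least {p = ⁅ x ⁆} ∪ʳ (∪ˡ ∘ cl-extensive)) z∈
      H⊆S : ∀ {z} → z ∈ H → S z
      H⊆S = cl-⟨⟩⊆ xs (Sxs ∘ there)
      go : Dec (z ∈ H) → Dec (x ∈ H) → Dec (x ∥ z) → S z
      go (yes z∈H) _ _ = H⊆S z∈H
      go (no _) (yes x∈H) _ = H⊆S (cover-least cl-flat ⊆-refl x∈H z∈cover)
      go (no _) (no _) (yes x∥z) = S-∥ (Sxs (here refl)) x∥z
      go (no z∉H) (no x∉H) (no x∦z) =
        let h , h∈H , t = meet cl-flat ∈cover z∈cover x∉H z∉H x∦z
        in S-triangle (H⊆S h∈H) (Sxs (here refl)) (rotate (rotate t))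

    cl⊆ : ∀ {X} → (∀ {x} → x ∈ X → S x) → ∀ {z} → z ∈ ⟪ X ⟫ → S z
    cl⊆ {X} SX z∈ = cl-⟨⟩⊆ (elements X) (SX ∘ elements⁻) (cl-mono ⊆⟨elements⟩ z∈)

  abstract

    -- The Veblen-Young axiom: the plane of `p`, `x`, `y` is the cover of `line z w` by `p`, so
    -- `meet` applies with that line as hyperplane.
    pasch : ∀ {p x y z w} → Triangle p x z → Triangle p y w → y ∉ line p x →
      ∃ λ q → Triangle x y q × Triangle z w q
    pasch {p} {x} {y} {z} {w} pxz@(p∦x , x∦z , p∦z , z∈) pyw@(p∦y , y∦w , p∦w , w∈) y∉L =
      let q , q∈G , xyq@(_ , y∦q , x∦q , q∈) = meet {a = p} cl-flat x∈cover y∈cover x∉G y∉G x∦y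
          z∦q = λ z∥q → y∉L (triangle-∈ cl-flat (rotate (rotate xyq)) (∥-closed cl-flat z∈ z∥q) ∈line₂)
          w∦q = λ w∥q → y∉L (line-exchange ∈line₁
                  (triangle-∈ cl-flat (rotate xyq) ∈line₂ (∥-closed cl-flat w∈ w∥q)) p∦x ∈line₂)
      in q , xyq , (z∦w , w∦q , z∦q , q∈G)
      where
      w∉L : w ∉ line p x
      w∉L w∈L = y∉L (triangle-∈ cl-flat (flip pyw) ∈line₁ w∈L)
      z∦w : z ∦ w
      z∦w = w∉L ∘ ∥-closed cl-flat z∈
      x∦y : x ∦ y
      x∦y = y∉L ∘ ∥-closed cl-flat ∈line₂
      x∈cover : x ∈ cover (line z w) p
      x∈cover = triangle-∈ cl-flat (flip pxz) ∈cover (⊆cover ∈line₁)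
      y∈cover : y ∈ cover (line z w) p
      y∈cover = triangle-∈ cl-flat (flip pyw) ∈cover (⊆cover ∈line₂)
      p∉G : p ∉ line z w
      p∉G p∈G = w∉L (line-exchange p∈G (triangle-∈ cl-flat (flip pxz) p∈G ∈line₁) p∦x ∈line₂)
      x∉G : x ∉ line z w
      x∉G x∈G = p∉G (triangle-∈ cl-flat (rotate pxz) x∈G ∈line₁)
      y∉G : y ∉ line z w
      y∉G y∈G = p∉G (triangle-∈ cl-flat (rotate pyw) y∈G ∈line₂)

  -- An analogue of invariance under elations with centre `q` and axis `H`. `P` will be a colour, or
  -- a colour within one cover of `H`.
  Stabilizes : Subset n → (Fin n → Set) → Fin n → Set
  Stabilizes H P q = q ∈ H × (∀ {u v} → u ∉ H → P u → Triangle q u v → P v)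

  -- For `z` on the line `x y`, a move from `u` to `v` through `z` factors, by Pasch, into a move
  -- from `u` to `g` through `y` and one from `g` to `v` through `x`.
  cl⊆Stabilizes : ∀ {H P} → IsFlat M H → ∀ {X} → (∀ {x} → x ∈ X → Stabilizes H P x) →
    ∀ {z} → z ∈ ⟪ X ⟫ → Stabilizes H P z
  cl⊆Stabilizes {H} {P} flat = cl⊆ (Stabilizes H P)
    (λ (x∈H , stab) x∥y → ∥-closed flat x∈H x∥y ,
      λ u∉H Pu t → stab u∉H Pu (triangle-∥ (∥-sym x∥y) t))
    closed
    where
    closed : ∀ {x y z} → Stabilizes H P x → Stabilizes H P y → Triangle x y z → Stabilizes H P z
    closed {x} {y} {z} (x∈H , stab-x) (y∈H , stab-y) xyz = z∈H , λ {u} {v} u∉H Pu zuv →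
      let v∉H = λ v∈H → u∉H (triangle-∈ flat (flip zuv) z∈H v∈H)
          g , xvg , yug = pasch (rotate (rotate xyz)) (flip zuv)
                            (v∉H ∘ line-least flat z∈H x∈H)
          g∉H = λ g∈H → u∉H (triangle-∈ flat (flip yug) y∈H g∈H)
      in stab-x g∉H (stab-y u∉H Pu yug) (flip xvg)
      where z∈H = triangle-∈ flat xyz x∈H y∈H

-- Finiteness: injective self-maps

module _ {n : ℕ} {D : Fin n → Set} {_~_ : Fin n → Fin n → Set} (~-refl : ∀ {x} → x ~ x) where

  -- If `x₀` were missed, its iterates would be pairwise unrelated: injectivity strips common
  -- applications of `f` until `x₀` stands alone on one side. Yet two of the first `n + 1` coincide.
  injection-onto : (f : Σ (Fin n) D → Σ (Fin n) D) →
    (∀ x y → proj₁ (f x) ~ proj₁ (f y) → proj₁ x ~ proj₁ y) →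
    (x₀ : Σ (Fin n) D) → ¬ (∀ y → ¬ proj₁ x₀ ~ proj₁ (f y))
  injection-onto f injective x₀ missed =
    let i , j , i<j , eq = Finₚ.pigeonhole ≤-refl (proj₁ ∘ iterate ∘ Fin.toℕ)
    in distinct i<j (subst (proj₁ (iterate (Fin.toℕ i)) ~_) eq ~-refl)
    where
    iterate : ℕ → Σ (Fin n) D
    iterate zero    = x₀
    iterate (suc m) = f (iterate m)
    distinct : ∀ {i j} → i < j → ¬ proj₁ (iterate i) ~ proj₁ (iterate j)
    distinct {zero}  {suc j} _         = missed (iterate j)
    distinct {suc i} {suc j} (s≤s i<j) = distinct i<j ∘ injective (iterate i) (iterate j)

-- Orderings of three colours

Palette : Fin 3 → Fin 3 → Fin 3 → Set
Palette i j k = i ≢ j × j ≢ k × i ≢ k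

complete : ∀ {i j k} → Palette i j k → ∀ {l} → l ≢ i → l ≢ j → l ≡ k
complete {i} {j} {k} (i≢j , j≢k , i≢k) {l} = toWitness {a? = all-complete?} _ i j k l i≢j j≢k i≢k
  where
  all-complete? = Finₚ.all? λ i → Finₚ.all? λ j → Finₚ.all? λ k → Finₚ.all? λ l →
    ¬? (i Finₚ.≟ j) →-dec ¬? (j Finₚ.≟ k) →-dec ¬? (i Finₚ.≟ k) →-dec
    ¬? (l Finₚ.≟ i) →-dec ¬? (l Finₚ.≟ j) →-dec (l Finₚ.≟ k)

palette-rotate : ∀ {i j k} → Palette i j k → Palette j k i
palette-rotate (i≢j , j≢k , i≢k) = j≢k , ≢-sym i≢k , ≢-sym i≢j

palette-reverse : ∀ {i j k} → Palette i j k → Palette k j i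
palette-reverse (i≢j , j≢k , i≢k) = ≢-sym j≢k , ≢-sym i≢j , ≢-sym i≢k

palette-flip : ∀ {i j k} → Palette i j k → Palette i k j
palette-flip (i≢j , j≢k , i≢k) = i≢k , ≢-sym j≢k , i≢j

palette-with : ∀ j → ∃ λ i → ∃ λ k → Palette i j k
palette-with zero             = suc zero , suc (suc zero) , (λ ()) , (λ ()) , λ ()
palette-with (suc zero)       = zero , suc (suc zero) , (λ ()) , (λ ()) , λ ()
palette-with (suc (suc zero)) = zero , suc zero , (λ ()) , (λ ()) , λ ()

palette-third : ∀ {i j} → i ≢ j → ∃ λ k → Palette i j k
palette-third {i} {j} = toWitness {a? = all-third?} _ i j
  where
  all-third? = Finₚ.all? λ i → Finₚ.all? λ j → ¬? (i Finₚ.≟ j) →-dec Finₚ.any? λ k →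
    ¬? (i Finₚ.≟ j) ×-dec ¬? (j Finₚ.≟ k) ×-dec ¬? (i Finₚ.≟ k)

-- Three spanning colour classes

module ThreeColours {n : ℕ} (M : Matroid n)
  (connected : IsConnected M) (modular : IsModular M) (2≤rank : 2 ≤ rank M)
  (c : Fin n → Fin 3)
  (rainbow-free : ∀ {x y z} → Closure.Triangle M x y z → ¬ Palette (c x) (c y) (c z))
  (spanning : ∀ i {G} → IsFlat M G → (∀ {x} → c x ≡ i → x ∈ G) → ∀ x → x ∈ G) where
  open Closure M
  open Projective M connected modular 2≤rank

  rainbow : ∀ {i j k x y z} → Palette i j k → Triangle x y z → c x ≡ i → c y ≡ j → c z ≢ k
  rainbow pal t refl refl refl = rainbow-free t pal

  ∥-stable : ∀ {x y} → ¬ x ∦ y → x ∥ y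
  ∥-stable {x} {y} = decidable-stable (x ∥? y)

  -- Project the γ-points of st from b to qt and back from a: this is injective on γ-points (up to
  -- parallelism) and misses s, which is the image of the α-point q.
  module Perspectivities {α β γ : Fin 3} (pal : Palette α β γ) {s t h a q b : Fin n}
    (cs : c s ≡ γ) (ct : c t ≡ γ) (ch : c h ≡ β) (sth : Triangle s t h)
    (ca : c a ≡ α) (cq : c q ≡ α) (aqs : Triangle a q s)
    (cb : c b ≡ β) (hab : Triangle h a b) where

    βγα = palette-rotate pal
    γαβ = palette-rotate βγα
    γβα = palette-reverse pal
    βαγ = palette-rotate γβα
    αγβ = palette-rotate βαγ

    L = line s t

    s∦t : s ∦ t
    s∦t = proj₁ sth

    s∦h : s ∦ h
    s∦h = proj₁ (flip sth)

    h∈L : h ∈ L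
    h∈L = triangle-∈ cl-flat sth ∈line₁ ∈line₂

    -- Otherwise `a`, `h`, `s` would be a rainbow triangle on `L`.
    a∉L : a ∉ L
    a∉L a∈L = rainbow pal
      (proj₁ (swap hab) , s∦h ∘ ∥-sym , proj₁ (flip aqs) , s∈line) ca ch cs
      where
      s∈line : s ∈ line a h
      s∈line = line-exchange a∈L h∈L (proj₁ hab ∘ ∥-sym) ∈line₁

    q∉L : q ∉ L
    q∉L q∈L = a∉L (triangle-∈ cl-flat (rotate aqs) q∈L ∈line₁)

    b∉L : b ∉ L
    b∉L b∈L = a∉L (triangle-∈ cl-flat (flip hab) h∈L b∈L)

    s∉line-qt : s ∉ line q t
    s∉line-qt s∈ = q∉L (line-exchange s∈ ∈line₂ s∦t ∈line₁)

    a∉line-qt : a ∉ line q t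
    a∉line-qt a∈ = s∉line-qt (triangle-∈ cl-flat aqs a∈ ∈line₁)

    -- The one point of `L` that would be sent to `s`: `b` projects `p` to `q`, and `a` projects `q`
    -- to `s`. It is no γ-point, since `b`, `q`, `p` would be rainbow.
    centre : ∃ λ p → Triangle b q p × Triangle h s p
    centre = pasch (rotate hab) aqs λ q∈ → a∉L (line-least cl-flat h∈L ∈line₁
      (line-exchange (triangle-∈ cl-flat (rotate hab) ∈line₁ ∈line₂) (triangle-∈ cl-flat aqs ∈line₁ q∈)
        (s∦h ∘ ∥-sym) ∈line₁))

    On-L : Fin n → Set
    On-L z = c z ≡ γ × z ∈ L

    -- `w` is the projection of `z` from `b` to the line `q t`, and `z′` that of `w` from `a` to
    -- `L`. The point `t` lies on both lines and is fixed; its triangles degenerate, hence `stay`.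
    data Step (z z′ : Fin n) : Set where
      stay : z ∥ t → z′ ∥ t → Step z z′
      move : ∀ w → Triangle b z w → Triangle q t w → Triangle t s z′ → Triangle w a z′ → Step z z′

    move-step : ∀ {z} → On-L z → z ∦ t → ∃ λ z′ → On-L z′ × Step z z′
    move-step {z} (cz , z∈L) z∦t =
      let p , bqp , hsp = centre
          p∈L = triangle-∈ cl-flat hsp h∈L ∈line₁
          p≁ : ∀ {y} → c y ≡ γ → p ∦ y
          p≁ cy = λ p∥y → rainbow γβα (triangle-∥ p∥y (rotate (rotate bqp))) cy cb cq
          pzt = p≁ cz , z∦t , p≁ ct , line-exchange p∈L z∈L (p≁ cz) ∈line₂
          w , bzw , qtw = pasch (rotate (rotate bqp)) pzt
            λ z∈ → b∉L (line-least cl-flat p∈L z∈L (line-exchange ∈line₁ z∈ (p≁ cz) ∈line₂))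
          cw = complete pal (rainbow βγα bzw cb cz) (rainbow αγβ qtw cq ct)
          z′ , tsz′ , waz′ = pasch qtw (rotate aqs) s∉line-qt
          z′∈L = triangle-∈ cl-flat tsz′ ∈line₂ ∈line₁
      in z′ , (complete pal (not-α cw tsz′ waz′ z′∈L) (rainbow γαβ waz′ cw ca) , z′∈L) ,
         move w bzw qtw tsz′ waz′
      where
      -- An α-point `z′` would be rainbow with `s` and `h` or, if parallel to `h`, would make `h`,
      -- `w`, `a` rainbow.
      not-α : ∀ {w z′} → c w ≡ γ → Triangle t s z′ → Triangle w a z′ → z′ ∈ L → c z′ ≢ α
      not-α {w} {z′} cw tsz′ waz′ z′∈L cz′ = rainbow γαβ (s∦z′ , z′∦h , s∦h , h∈line) cs cz′ ch
        where
        s∦z′ : s ∦ z′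
        s∦z′ = proj₁ (rotate tsz′)
        z′∦h : z′ ∦ h
        z′∦h z′∥h = rainbow βγα (triangle-∥ z′∥h (rotate (rotate waz′))) ch cw ca
        h∈line : h ∈ line s z′
        h∈line = line-exchange ∈line₁ z′∈L s∦z′ h∈L

    step : ∀ {z} → On-L z → ∃ λ z′ → On-L z′ × Step z z′
    step {z} oz = by-cases (z ∥? t)
      where
      by-cases : Dec (z ∥ t) → ∃ λ z′ → On-L z′ × Step z z′
      by-cases (yes z∥t) = z , oz , stay z∥t z∥t
      by-cases (no z∦t)  = move-step oz z∦t

    -- Each projection can be undone: different `w` with one image would put `a` on the line `q t`,
    -- and different `z` with one `w` would put `b` on `L`.
    step-injective : ∀ {z₁ z₂ z₁′ z₂′} → z₁ ∈ L → z₂ ∈ L → Step z₁ z₁′ → Step z₂ z₂′ →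
      z₁′ ∥ z₂′ → z₁ ∥ z₂
    step-injective _ _ (stay z₁∥t _) (stay z₂∥t _) _ = ∥-trans z₁∥t (∥-sym z₂∥t)
    step-injective _ _ (stay _ z₁′∥t) (move _ _ _ tsz₂′ _) z₁′∥z₂′ =
      ⊥-elim (proj₁ (rotate (rotate tsz₂′)) (∥-trans (∥-sym z₁′∥z₂′) z₁′∥t))
    step-injective _ _ (move _ _ _ tsz₁′ _) (stay _ z₂′∥t) z₁′∥z₂′ =
      ⊥-elim (proj₁ (rotate (rotate tsz₁′)) (∥-trans z₁′∥z₂′ z₂′∥t))
    step-injective {z₁} {z₂} {z₁′} z₁∈L z₂∈L
      (move w₁ bz₁w₁ qtw₁ tsz₁′ w₁az₁′) (move w₂ bz₂w₂ qtw₂ tsz₂′ w₂az₂′) z₁′∥z₂′ =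
      ∥-stable λ z₁∦z₂ → b∉L (line-least cl-flat z₁∈L z₂∈L
        (line-exchange (triangle-∈ cl-flat (flip bz₁w₁) ∈line₁ ∈line₂)
                       (triangle-∈ cl-flat (flip bz₂w₂) ∈line₁ (∥-closed cl-flat ∈line₂ w₁∥w₂))
                       z₁∦z₂ ∈line₁))
      where
      w₁∥w₂ : w₁ ∥ w₂
      w₁∥w₂ = ∥-stable λ w₁∦w₂ → a∉line-qt (line-least cl-flat
        (triangle-∈ cl-flat qtw₁ ∈line₁ ∈line₂) (triangle-∈ cl-flat qtw₂ ∈line₁ ∈line₂)
        (line-exchange (triangle-∈ cl-flat (rotate w₁az₁′) ∈line₁ ∈line₂)
                       (triangle-∈ cl-flat (rotate w₂az₂′) ∈line₁ (∥-closed cl-flat ∈line₂ z₁′∥z₂′))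
                       w₁∦w₂ ∈line₁))

    impossible : ⊥
    impossible = injection-onto {D = On-L} {_~_ = _∥_} ∥-refl
      (λ (z , oz) → let z′ , oz′ , _ = step oz in z′ , oz′)
      (λ (z₁ , oz₁) (z₂ , oz₂) → let _ , _ , st₁ = step oz₁ ; _ , _ , st₂ = step oz₂
                                 in step-injective (proj₂ oz₁) (proj₂ oz₂) st₁ st₂)
      (s , cs , ∈line₁)
      (λ (z , oz) → let _ , _ , st = step oz in s∦step st)
      where
      s∦step : ∀ {z z′} → Step z z′ → s ∦ z′
      s∦step (stay _ z′∥t) s∥z′      = s∦t (∥-trans s∥z′ z′∥t)
      s∦step (move _ _ _ tsz′ _) s∥z′ = proj₁ (rotate tsz′) s∥z′

  -- Monochromatic layers and their enlargement

  record MonochromaticLayer (H F : Subset n) (β : Fin 3) : Set where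
    field
      flat-H  : IsFlat M H
      flat-F  : IsFlat M F
      F⊆H     : F ⊆ H
      {h₀}    : Fin n
      h₀∈H    : h₀ ∈ H
      h₀∉F    : h₀ ∉ F
      mono    : ∀ {x} → x ∈ H → x ∉ F → c x ≡ β

  escape : ∀ i {G y} → IsFlat M G → y ∉ G → ¬ (∀ {x} → c x ≡ i → x ∉ G → ⊥)
  escape i {G} {y} flat y∉G none = y∉G (spanning i flat (λ {x} cx → decidable-stable (x ∈? G) (none cx)) y)

  -- Otherwise exchange puts `v` into `cover F h`, which lies in `H`. This keeps enlarged layers
  -- nonempty.
  ∉cover : ∀ {F H h v} → IsFlat M F → IsFlat M H → F ⊆ H → h ∈ H → h ∉ F → v ∉ H → h ∉ cover F v
  ∉cover flatF flatH F⊆H h∈H h∉F v∉H h∈ = v∉H (cover-least flatH F⊆H h∈H (exchange flatF h∈ h∉F))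

  module Enlarge {H F : Subset n} {β : Fin 3} (layer : MonochromaticLayer H F β)
    (maximal : ∀ {H′ F′ β′} → H ⊂ H′ → ¬ MonochromaticLayer H′ F′ β′) where
    open MonochromaticLayer layer

    ⊂cover : ∀ {x} → x ∉ H → H ⊂ cover H x
    ⊂cover {x} x∉H = ⊆cover , x , ∈cover , x∉H

    cover-cover : ∀ {x y} → x ∈ cover H y → cover H x ⊆ cover H y
    cover-cover = cover-least cl-flat ⊆cover

    -- Otherwise `cover H x` over `cover F y` is a larger layer. A line joining an α-point and a
    -- γ-point of `cover H x ─ H` meets `H`, and must do so in `F` to avoid a rainbow. Comparison
    -- with `x` and `y` thus puts all α- and γ-points into `cover F y`.
    mixed : ∀ {α γ x y} → Palette α β γ → x ∉ H → y ∉ H → c x ≡ α → c y ≡ γ → y ∉ cover H x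
    mixed {α} {γ} {x} {y} pal x∉H y∉H cx cy y∈ = maximal (⊂cover x∉H) record
      { flat-H = cl-flat
      ; flat-F = cl-flat
      ; F⊆H    = cover-least cl-flat (⊆cover ∘ F⊆H) y∈
      ; h₀∈H   = ⊆cover h₀∈H
      ; h₀∉F   = ∉cover flat-F flat-H F⊆H h₀∈H h₀∉F y∉H
      ; mono   = λ {z} → mono′ {z} (z ∈? H)
      }
      where
      F′ : Subset n
      F′ = cover F y
      joined : ∀ {z w i j} → Palette i β j → z ∈ cover H x → w ∈ cover H x → z ∉ H → w ∉ H →
        c z ≡ i → c w ≡ j → w ∈ F′ → z ∈ F′
      joined {z} {w} {i} {j} pal′ z∈ w∈ z∉H w∉H cz cw w∈F′ = by-cases (z ∥? w)
        where
        via : ∀ h → h ∈ H → Triangle z w h → Dec (h ∈ F) → z ∈ F′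
        via h h∈H zwh (yes h∈F) = triangle-∈ cl-flat (rotate zwh) w∈F′ (⊆cover h∈F)
        via h h∈H zwh (no h∉F)  = ⊥-elim (rainbow pal′ (flip zwh) cz (mono h∈H h∉F) cw)
        by-cases : Dec (z ∥ w) → z ∈ F′
        by-cases (yes z∥w) = ∥-closed cl-flat w∈F′ (∥-sym z∥w)
        by-cases (no z∦w)  = let h , h∈H , zwh = meet flat-H z∈ w∈ z∉H w∉H z∦w
                             in via h h∈H zwh (h ∈? F)
      x∈F′ : x ∈ F′
      x∈F′ = joined pal ∈cover y∈ x∉H y∉H cx cy ∈cover
      mono′ : ∀ {z} → Dec (z ∈ H) → z ∈ cover H x → z ∉ F′ → c z ≡ β
      mono′ (yes z∈H) _ z∉F′ = mono z∈H (z∉F′ ∘ ⊆cover)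
      mono′ {z} (no z∉H) z∈ z∉F′ = complete (palette-flip pal)
        (λ cz → z∉F′ (joined pal z∈ y∈ z∉H y∉H cz cy ∈cover))
        (λ cz → z∉F′ (joined (palette-reverse pal) z∈ ∈cover z∉H x∉H cz cx x∈F′))

    module ThirdCover {α γ : Fin 3} (pal : Palette α β γ) {u v w : Fin n}
      (u∉H : u ∉ H) (v∉H : v ∉ H) (cu : c u ≡ α) (cv : c v ≡ γ) (cw : c w ≡ α)
      (uvw : Triangle u v w) where

      βγα = palette-rotate pal
      γαβ = palette-rotate βγα
      γβα = palette-reverse pal
      βαγ = palette-rotate γβα
      αγβ = palette-rotate βαγ

      w∉H : w ∉ H
      w∉H w∈H = mixed pal u∉H v∉H cu cv (triangle-∈ cl-flat (flip uvw) ∈cover (⊆cover w∈H))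

      Typed : Fin n → Fin 3 → Fin n → Set
      Typed y i z = z ∈ cover H y × z ∉ H × c z ≡ i

      abstract

        -- `cover H w` is a hyperplane in the span of `H`, `u`, `v`, so the line `x y` meets it. At
        -- the meeting point γ is excluded by `mixed` against `w`, and β by rainbow-freeness.
        third-∈α : ∀ {x y} → Typed u α x → Typed v γ y → ∃ λ q → Triangle x y q × c q ≡ α
        third-∈α {x} {y} (x∈ , x∉H , cx) (y∈ , y∉H , cy) =
          let q , q∈ , xyq = meet cl-flat x∈G y∈G x∉ y∉ x∦y
              q∉H = λ q∈H → mixed pal x∉H y∉H cx cy (triangle-∈ cl-flat (flip xyq) ∈cover (⊆cover q∈H))
          in q , xyq , complete βγα (rainbow αγβ xyq cx cy) (λ cq → mixed pal w∉H q∉H cw cq q∈)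
          where
          x∈G : x ∈ cover (cover H w) u
          x∈G = cover-least cl-flat (⊆cover ∘ ⊆cover) ∈cover x∈
          y∈G : y ∈ cover (cover H w) u
          y∈G = cover-least cl-flat (⊆cover ∘ ⊆cover)
            (triangle-∈ cl-flat (flip uvw) ∈cover (⊆cover ∈cover)) y∈
          x∉ : x ∉ cover H w
          x∉ x∈w = mixed pal u∉H v∉H cu cv
            (triangle-∈ cl-flat (flip uvw) ∈cover (cover-cover x∈ (exchange flat-H x∈w x∉H)))
          y∉ : y ∉ cover H w
          y∉ = mixed pal w∉H y∉H cw cy
          x∦y : x ∦ y
          x∦y x∥y = mixed pal x∉H y∉H cx cy (∥-closed cl-flat ∈cover x∥y)

      -- The second summand makes cover H v ─ cover T v monochromatic on H as well.
      Direction : Fin n → Set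
      Direction h = (h ∈ H × h ∉ F × ∃ λ s → ∃ λ t → Typed v γ s × Typed v γ t × Triangle s t h)
                  ⊎ (h ∈ F × c h ≡ γ)

      typed? : ∀ z → Dec (Typed v γ z)
      typed? z = z ∈? cover H v ×-dec ¬? (z ∈? H) ×-dec (c z Finₚ.≟ γ)

      direction? : ∀ h → Dec (Direction h)
      direction? h =
        (h ∈? H ×-dec ¬? (h ∈? F) ×-dec
          Finₚ.any? λ s → Finₚ.any? λ t → typed? s ×-dec typed? t ×-dec triangle? s t h)
        ⊎-dec (h ∈? F ×-dec (c h Finₚ.≟ γ))

      T : Subset n
      T = ⟪ tabulate (λ h → ⌊ direction? h ⌋) ⟫

      direction-∈T : ∀ {h} → Direction h → h ∈ T
      direction-∈T = cl-extensive ∘ ∈-tabulate⁺ direction?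

      -- For a secant direction, a β-point on the line from `h` to an α-point completes the
      -- configuration of `Perspectivities`. For a γ-point of `F`, rainbow-freeness excludes β and
      -- `mixed` excludes γ.
      direction-stabilizes : ∀ {h} → Direction h → Stabilizes H (λ z → z ∈ cover H u × c z ≡ α) h
      direction-stabilizes {h} (inj₁ (h∈H , h∉F , s , t , ts@(_ , _ , cs) , (_ , _ , ct) , sth)) =
        h∈H , λ {a} {z} a∉H (a∈ , ca) haz →
          let ch = mono h∈H h∉F
              q , asq , cq = third-∈α (a∈ , a∉H , ca) ts
          in triangle-∈ cl-flat haz (⊆cover h∈H) a∈ ,
             complete βγα (λ cz → Perspectivities.impossible pal cs ct ch sth ca cq (flip asq) cz haz)
                          (rainbow βαγ haz ch ca)
      direction-stabilizes {h} (inj₂ (h∈F , ch)) =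
        F⊆H h∈F , λ {a} {z} a∉H (a∈ , ca) haz →
          let z∉H = λ z∈H → a∉H (triangle-∈ flat-H (flip haz) (F⊆H h∈F) z∈H)
          in triangle-∈ cl-flat haz (⊆cover (F⊆H h∈F)) a∈ ,
             complete βγα (rainbow γαβ haz ch ca)
               (λ cz → mixed pal a∉H z∉H ca cz (triangle-∈ cl-flat haz (⊆cover (F⊆H h∈F)) ∈cover))

      T-stabilizes : ∀ {h} → h ∈ T → Stabilizes H (λ z → z ∈ cover H u × c z ≡ α) h
      T-stabilizes = cl⊆Stabilizes flat-H (direction-stabilizes ∘ ∈-tabulate⁻ direction?)

      T⊆H : T ⊆ H
      T⊆H = proj₁ ∘ T-stabilizes

      secant-∈T : ∀ {s t h} → Typed v γ s → Typed v γ t → Triangle s t h → h ∈ H → h ∉ F → h ∈ T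
      secant-∈T ts tt sth h∈H h∉F = direction-∈T (inj₁ (h∈H , h∉F , _ , _ , ts , tt , sth))

      v-typed : Typed v γ v
      v-typed = ∈cover , v∉H , cv

      -- The γ-points of cover H v ─ H differ from v by directions in F or in T: as for a group
      -- contained in the union of two subgroups, one of the two suffices.
      not-both : ∀ {s t} → Typed v γ s → s ∉ cover F v → Typed v γ t → t ∉ cover T v → ⊥
      not-both {s} {t} ts@(s∈ , s∉H , cs) s∉ tt@(t∈ , t∉H , ct) t∉ =
        let f , f∈H , vsf = meet flat-H ∈cover s∈ v∉H s∉H
                              (λ v∥s → s∉ (∥-closed cl-flat ∈cover v∥s))
            g , g∈H , vtg = meet flat-H ∈cover t∈ v∉H t∉H
                              (λ v∥t → t∉ (∥-closed cl-flat ∈cover v∥t))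
            f∉F = λ f∈F → s∉ (triangle-∈ cl-flat (flip vsf) ∈cover (⊆cover f∈F))
            s∈T = triangle-∈ cl-flat (flip vsf) ∈cover (⊆cover (secant-∈T v-typed ts vsf f∈H f∉F))
            g∈F = decidable-stable (g ∈? F) λ g∉F →
                    t∉ (triangle-∈ cl-flat (flip vtg) ∈cover (⊆cover (secant-∈T v-typed tt vtg g∈H g∉F)))
            t∈F = triangle-∈ cl-flat (flip vtg) ∈cover (⊆cover g∈F)
            -- Now `s` is in `cover T v` and `t` in `cover F v`, so `h` can lie neither in `F` nor
            -- in `T`; but `secant-∈T` forces one of them.
            h , h∈H , sth = meet flat-H s∈ t∈ s∉H t∉H
                              (λ s∥t → s∉ (∥-closed cl-flat t∈F (∥-sym s∥t)))
            h∉F = λ h∈F → s∉ (triangle-∈ cl-flat (rotate sth) t∈F (⊆cover h∈F))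
        in t∉ (triangle-∈ cl-flat (flip sth) s∈T (⊆cover (secant-∈T ts tt sth h∈H h∉F)))

      not-α : ∀ {z} → z ∈ cover H v → z ∉ H → c z ≢ α
      not-α z∈ z∉H cz = mixed pal z∉H v∉H cz cv (exchange flat-H z∈ z∉H)

      -- Given one γ-point off `cover F v`, `not-both` puts all γ-points of `cover H v ─ H` into
      -- `cover T v`, so `cover H v` over `cover T v` is a larger layer.
      outside-T : ∀ {h s} → h ∈ H → h ∉ T → Typed v γ s → s ∉ cover F v → ⊥
      outside-T {h} {s} h∈H h∉T ts s∉ = maximal (⊂cover v∉H) record
        { flat-H = cl-flat
        ; flat-F = cl-flat
        ; F⊆H    = cover-least cl-flat (⊆cover ∘ T⊆H) ∈cover
        ; h₀∈H   = ⊆cover h∈H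
        ; h₀∉F   = ∉cover cl-flat flat-H T⊆H h∈H h∉T v∉H
        ; mono   = λ {z} z∈ z∉ → complete αγβ (not-α′ z∈ z∉ (z ∈? H)) (not-γ z∈ z∉ (z ∈? H))
        }
        where
        not-γ : ∀ {z} → z ∈ cover H v → z ∉ cover T v → Dec (z ∈ H) → c z ≢ γ
        not-γ {z} z∈ z∉ (yes z∈H) cz = z∉ (⊆cover (direction-∈T (inj₂ (z∈F , cz))))
          where
          z∈F : z ∈ F
          z∈F = decidable-stable (z ∈? F) λ z∉F → proj₁ (proj₂ pal) (trans (sym (mono z∈H z∉F)) cz)
        not-γ z∈ z∉ (no z∉H) cz = not-both ts s∉ (z∈ , z∉H , cz) z∉
        not-α′ : ∀ {z} → z ∈ cover H v → z ∉ cover T v → Dec (z ∈ H) → c z ≢ α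
        not-α′ z∈ z∉ (no z∉H) cz = not-α z∈ z∉H cz
        -- The third point `y` of the line `v z` is off both `H` and `cover T v`, hence β, which
        -- makes `v`, `z`, `y` rainbow.
        not-α′ {z} z∈ z∉ (yes z∈H) cz =
          let y , vzy = third λ v∥z → v∉H (∥-closed flat-H z∈H (∥-sym v∥z))
              y∈  = triangle-∈ cl-flat vzy ∈cover (⊆cover z∈H)
              y∉  = λ y∈ → z∉ (triangle-∈ cl-flat (flip vzy) ∈cover y∈)
              y∉H = λ y∈H → v∉H (triangle-∈ flat-H (rotate vzy) z∈H y∈H)
          in rainbow γαβ vzy cv cz
               (complete αγβ (not-α y∈ y∉H) (not-γ y∈ y∉ (no y∉H)))

      proper-T : ∀ {h} → h ∈ H → h ∉ T → ⊥
      proper-T {h} h∈H h∉T = maximal (⊂cover v∉H) record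
        { flat-H = cl-flat
        ; flat-F = cl-flat
        ; F⊆H    = cover-least cl-flat (⊆cover ∘ F⊆H) ∈cover
        ; h₀∈H   = ⊆cover h₀∈H
        ; h₀∉F   = ∉cover flat-F flat-H F⊆H h₀∈H h₀∉F v∉H
        ; mono   = λ {z} z∈ z∉ → mono′ z∈ z∉ (z ∈? H)
        }
        where
        mono′ : ∀ {z} → z ∈ cover H v → z ∉ cover F v → Dec (z ∈ H) → c z ≡ β
        mono′ z∈ z∉ (yes z∈H) = mono z∈H (z∉ ∘ ⊆cover)
        mono′ z∈ z∉ (no z∉H)  = complete αγβ (not-α z∈ z∉H)
          (λ cz → outside-T h∈H h∉T (z∈ , z∉H , cz) z∉)

      -- By `proper-T` every point of `H` is in `T`, so lines through `H` carry the colour of `u` to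
      -- the rest of `cover H u ─ H`. The new layer has colour α.
      impossible : ⊥
      impossible = maximal (⊂cover u∉H) record
        { flat-H = cl-flat
        ; flat-F = flat-H
        ; F⊆H    = ⊆cover
        ; h₀∈H   = ∈cover
        ; h₀∉F   = u∉H
        ; mono   = λ {z} z∈ z∉H → mono′ z∈ z∉H (u ∥? z)
        }
        where
        mono′ : ∀ {z} → z ∈ cover H u → z ∉ H → Dec (u ∥ z) → c z ≡ α
        -- A parallel copy of `u` gives no direction; the α-point on the line `u v` excludes β
        -- instead.
        mono′ {z} z∈ z∉H (yes u∥z) =
          let q , uvq , cq = third-∈α (∈cover , u∉H , cu) v-typed
          in complete βγα (λ cz → rainbow βγα (triangle-∥ u∥z uvq) cz cv cq)
               (λ cz → mixed pal u∉H z∉H cu cz z∈)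
        mono′ {z} z∈ z∉H (no u∦z) =
          let h , h∈H , uzh = meet flat-H ∈cover z∈ u∉H z∉H u∦z
              h∈T = decidable-stable (h ∈? T) (proper-T h∈H)
          in proj₂ (proj₂ (T-stabilizes h∈T) u∉H (∈cover , cu) (rotate (rotate uzh)))

    impossible : ⊥
    impossible =
      let α , γ , pal = palette-with β
      in escape α flat-F h₀∉F λ {u} cu u∉F → escape γ flat-F h₀∉F λ {v} cv v∉F →
           from-pair pal cu cv (outside pal cu u∉F) (outside (palette-reverse pal) cv v∉F)
      where
      outside : ∀ {α γ x} → Palette α β γ → c x ≡ α → x ∉ F → x ∉ H
      outside (α≢β , _) cx x∉F x∈H = α≢β (trans (sym cx) (mono x∈H x∉F))
      from-pair : ∀ {α γ u v} → Palette α β γ → c u ≡ α → c v ≡ γ → u ∉ H → v ∉ H → ⊥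
      from-pair {α} {γ} {u} {v} pal cu cv u∉H v∉H =
        let w , uvw = third λ u∥v → mixed pal u∉H v∉H cu cv (∥-closed cl-flat ∈cover u∥v)
        in rainbow (palette-flip pal) uvw cu cv
             (complete (palette-flip pal)
               (λ cw → ThirdCover.impossible pal u∉H v∉H cu cv cw uvw)
               -- The case of a γ-point `w` is the previous one with α and γ, and `u` and `v`,
               -- exchanged.
               (λ cw → ThirdCover.impossible (palette-reverse pal) v∉H u∉H cv cu cw (swap uvw)))

  -- `m` bounds the number of elements outside `H`, which drops with each enlargement.
  no-layer : ∀ m {H F β} → n ≤ m + ∣ H ∣ → ¬ MonochromaticLayer H F β
  no-layer zero n≤ layer = Enlarge.impossible layer λ {H′} H⊂H′ _ →
    <⇒≱ (p⊂q⇒∣p∣<∣q∣ H⊂H′) (≤-trans (∣p∣≤n H′) n≤)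
  no-layer (suc m) n≤ layer = Enlarge.impossible layer λ H⊂H′ →
    no-layer m (≤-trans n≤ (≤-trans (≤-reflexive (sym (+-suc m _))) (+-monoʳ-≤ m (p⊂q⇒∣p∣<∣q∣ H⊂H′))))

  -- Without loops `⟪ ∅ ⟫` is empty, so a parallel class of one colour is a first layer over it.
  no-pure-point : ∀ e → ¬ (∀ z → e ∥ z → c z ≡ c e)
  no-pure-point e pure = no-layer n (m≤m+n n _) record
    { flat-H = cl-flat {⁅ e ⁆}
    ; flat-F = cl-flat {∅}
    ; F⊆H    = ⊥-elim ∘ ∉cl∅
    ; h₀∈H   = ∈point
    ; h₀∉F   = ∉cl∅
    ; mono   = λ x∈ _ → pure _ (∈point⁻ x∈)
    }

  point-proper : ∀ e → ∃ λ y → y ∉ point e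
  point-proper e = Finₚ.¬∀⟶∃¬ n (_∈ point e) (_∈? point e) λ all∈ →
    <⇒≱ 2≤rank (≤-trans (r-≤ {⁅ e ⁆} λ {x} _ → all∈ x) (r-⁅⁆≤1 e))

  -- On the line from `e` to a point `x` of the third colour, triangles with `e` exclude the colour
  -- of `f` and conversely. So `line e x` over `point e` is a first layer.
  no-mixed-point : ∀ {e f} → e ∥ f → c e ≢ c f → ⊥
  no-mixed-point {e} {f} e∥f ce≢cf =
    let k , pal = palette-third ce≢cf
    in escape k cl-flat (proj₂ (point-proper e)) λ {x} cx x∉ →
         no-layer n (m≤m+n n _) (layer pal cx x∉)
    where
    layer : ∀ {k x} → Palette (c e) (c f) k → c x ≡ k → x ∉ point e →
      MonochromaticLayer (line e x) (point e) k
    layer {k} {x} pal cx x∉ = record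
      { flat-H = cl-flat
      ; flat-F = cl-flat
      ; F⊆H    = cl-mono ∪ˡ
      ; h₀∈H   = ∈line₂
      ; h₀∉F   = x∉
      ; mono   = λ {z} z∈ z∉ → mono z∈ z∉ (x ∥? z)
      }
      where
      e∦ : ∀ {z} → z ∉ point e → e ∦ z
      e∦ z∉ = z∉ ∘ ∥-closed cl-flat ∈point
      on-line : ∀ {w} → Triangle e x w → c w ≡ k
      on-line exw = complete pal
        (rainbow (palette-rotate pal) (triangle-∥ e∥f exw) refl cx)
        (rainbow (palette-flip pal) exw refl cx)
      mono : ∀ {z} → z ∈ line e x → z ∉ point e → Dec (x ∥ z) → c z ≡ k
      mono z∈ z∉ (no x∦z)  = on-line (e∦ x∉ , x∦z , e∦ z∉ , z∈)
      mono {z} z∈ z∉ (yes x∥z) =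
        let w , exw = third (e∦ x∉)
        in complete pal
             (λ cz → rainbow pal (triangle-∥ x∥z (swap (triangle-∥ e∥f exw))) cz refl (on-line exw))
             (λ cz → rainbow (palette-rotate (palette-reverse pal))
                       (triangle-∥ x∥z (swap exw)) cz refl (on-line exw))

  impossible : ⊥
  impossible = no-pure-point e λ z e∥z →
    decidable-stable (c z Finₚ.≟ c e) (no-mixed-point e∥z ∘ ≢-sym)
    where
    e = proj₁ (inhabited {⊤} (≤-trans (s≤s z≤n) 2≤rank))

-- Cardinalities of subsets

∈─⁻ : ∀ {n} {p q : Subset n} {x} → x ∈ p ─ q → x ∉ q
∈─⁻ {p = _ ∷ _} {q = false ∷ _} here ()
∈─⁻ {p = _ ∷ _} {q = true ∷ _}  ()   here
∈─⁻ {p = _ ∷ _} {q = _ ∷ _} (there x∈) (there x∈q) = ∈─⁻ x∈ x∈q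

∈-⇒≢ : ∀ {n} {p : Subset n} {x y} → y ∈ p - x → x ≢ y
∈-⇒≢ {p = p} {x} y∈ refl = ∈─⁻ {p = p} y∈ (x∈⁅x⁆ x)

∣p∪q∣≤∣p∣+∣q∣ : ∀ {n} (p q : Subset n) → ∣ p ∪ q ∣ ≤ ∣ p ∣ + ∣ q ∣
∣p∪q∣≤∣p∣+∣q∣ [] [] = z≤n
∣p∪q∣≤∣p∣+∣q∣ (true ∷ p) (x ∷ q) =
  s≤s (≤-trans (∣p∪q∣≤∣p∣+∣q∣ p q) (+-monoʳ-≤ ∣ p ∣ (∣p∣≤∣x∷p∣ x q)))
∣p∪q∣≤∣p∣+∣q∣ (false ∷ p) (true ∷ q) =
  ≤-trans (s≤s (∣p∪q∣≤∣p∣+∣q∣ p q)) (≤-reflexive (sym (+-suc ∣ p ∣ ∣ q ∣)))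
∣p∪q∣≤∣p∣+∣q∣ (false ∷ p) (false ∷ q) = ∣p∪q∣≤∣p∣+∣q∣ p q

remove-one : ∀ {n m} {p : Subset n} → suc m ≤ ∣ p ∣ → ∃ λ x → x ∈ p × m ≤ ∣ p - x ∣
remove-one {n} {p = p} m<∣p∣ = from (nonempty? p)
  where
  from : Dec (Nonempty p) → ∃ λ x → x ∈ p × _ ≤ ∣ p - x ∣
  from (yes (x , x∈p)) = x , x∈p , s≤s⁻¹ (≤-trans m<∣p∣ (≤-reflexive (∣p∣≡1+∣p-x∣ x∈p)))
  from (no empty) = ⊥-elim (<⇒≱ (≤-trans (s≤s z≤n) m<∣p∣)
    (≤-reflexive (trans (cong ∣_∣ (Empty-unique empty)) (∣⊥∣≡0 n))))

three-members : ∀ {n} {p : Subset n} → 3 ≤ ∣ p ∣ →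
  ∃ λ x → ∃ λ y → ∃ λ z → (x ∈ p × y ∈ p × z ∈ p) × (x ≢ y × x ≢ z × y ≢ z)
three-members {p = p} 3≤ =
  let x , x∈ , 2≤ = remove-one {p = p} 3≤
      y , y∈ , 1≤ = remove-one {p = p - x} 2≤
      z , z∈ , _  = remove-one {p = p - x - y} 1≤
      z∈p-x = p─q⊆p (p - x) ⁅ y ⁆ z∈
  in x , y , z , (x∈ , p─q⊆p p ⁅ x ⁆ y∈ , p─q⊆p p ⁅ x ⁆ z∈p-x) ,
     (∈-⇒≢ {p = p} y∈ , ∈-⇒≢ {p = p} z∈p-x , ∈-⇒≢ {p = p - x} z∈)

-- Colour classes and the decomposer

module _ {n k : ℕ} (c : Fin n → Fin k) where

  class : Fin k → Subset n
  class j = tabulate (λ x → ⌊ c x Finₚ.≟ j ⌋)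

  ∈class : ∀ {j x} → c x ≡ j → x ∈ class j
  ∈class {j} = ∈-tabulate⁺ (λ x → c x Finₚ.≟ j)

  ∈class⁻ : ∀ {j x} → x ∈ class j → c x ≡ j
  ∈class⁻ {j} = ∈-tabulate⁻ (λ x → c x Finₚ.≟ j)

module _ {n k : ℕ} (M : Matroid n) (c : Fin n → Fin k) (no-rainbow : NoRainbowTriangle M c) where
  open Matroid M
  open Closure M

  -- The three elements together have rank at most two, and each pair has rank two: they form a
  -- three-element circuit.
  triangle-colours : ∀ {x y z} → Triangle x y z → ¬ (c x ≢ c y × c y ≢ c z × c x ≢ c z)
  triangle-colours {x} {y} {z} (x∦y , y∦z , x∦z , z∈) (cx≢cy , cy≢cz , cx≢cz) =
    no-rainbow C ((dependent , independent) , ∣C∣≡3 , injective)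
    where
    C : Subset n
    C = (⁅ x ⁆ ∪ ⁅ y ⁆) ∪ ⁅ z ⁆
    x∈C : x ∈ C
    x∈C = ∪ˡ (∪ˡ (x∈⁅x⁆ x))
    y∈C : y ∈ C
    y∈C = ∪ˡ (∪ʳ {p = ⁅ x ⁆} (x∈⁅x⁆ y))
    z∈C : z ∈ C
    z∈C = ∪ʳ {p = ⁅ x ⁆ ∪ ⁅ y ⁆} (x∈⁅x⁆ z)
    members : ∀ {e} {P : Fin n → Set} → P x → P y → P z → e ∈ C → P e
    members {e} {P} Px Py Pz e∈ = [ [ at Px , at Py ]′ ∘ x∈p∪q⁻ ⁅ x ⁆ ⁅ y ⁆ , at Pz ]′
      (x∈p∪q⁻ (⁅ x ⁆ ∪ ⁅ y ⁆) ⁅ z ⁆ e∈)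
      where
      at : ∀ {w} → P w → e ∈ ⁅ w ⁆ → P e
      at {w} Pw e∈w = subst P (sym (x∈⁅y⁆⇒x≡y w e∈w)) Pw
    ∦⇒≢ : ∀ {u v} → u ∦ v → u ≢ v
    ∦⇒≢ u∦v refl = u∦v ∥-refl
    2≤r : ∀ {p u v} → u ∦ v → u ∈ p → v ∈ p → 2 ≤ r p
    2≤r u∦v u∈ v∈ = ≤-trans (≰⇒> u∦v) (r-mono (∪-least (⁅⁆⊆ u∈) (⁅⁆⊆ v∈)))
    ∣C∣≤3 : ∣ C ∣ ≤ 3
    ∣C∣≤3 = ≤-trans (∣p∪q∣≤∣p∣+∣q∣ (⁅ x ⁆ ∪ ⁅ y ⁆) ⁅ z ⁆)
      (+-mono-≤ (≤-trans (∣p∪q∣≤∣p∣+∣q∣ ⁅ x ⁆ ⁅ y ⁆)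
        (+-mono-≤ (≤-reflexive (∣⁅x⁆∣≡1 x)) (≤-reflexive (∣⁅x⁆∣≡1 y)))) (≤-reflexive (∣⁅x⁆∣≡1 z)))
    2≤r-C-e : ∀ {e} → e ∈ C → 2 ≤ r (C - e)
    2≤r-C-e = members {P = λ e → 2 ≤ r (C - e)}
      (2≤r y∦z (x∈p∧x≢y⇒x∈p-y y∈C (≢-sym (∦⇒≢ x∦y))) (x∈p∧x≢y⇒x∈p-y z∈C (≢-sym (∦⇒≢ x∦z))))
      (2≤r x∦z (x∈p∧x≢y⇒x∈p-y x∈C (∦⇒≢ x∦y)) (x∈p∧x≢y⇒x∈p-y z∈C (≢-sym (∦⇒≢ y∦z))))
      (2≤r x∦y (x∈p∧x≢y⇒x∈p-y x∈C (∦⇒≢ x∦z)) (x∈p∧x≢y⇒x∈p-y y∈C (∦⇒≢ y∦z)))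
    ∣C∣≡3 : ∣ C ∣ ≡ 3
    ∣C∣≡3 = ≤-antisym ∣C∣≤3 (≤-trans (s≤s (≤-trans (2≤r-C-e x∈C) (r-bound (C - x))))
      (≤-reflexive (sym (∣p∣≡1+∣p-x∣ x∈C))))
    independent : ∀ e → e ∈ C → r (C - e) ≡ ∣ C - e ∣
    independent e e∈ = ≤-antisym (r-bound (C - e)) (≤-trans
      (s≤s⁻¹ (≤-trans (≤-reflexive (sym (∣p∣≡1+∣p-x∣ e∈))) ∣C∣≤3)) (2≤r-C-e e∈))
    dependent : r C ≢ ∣ C ∣
    dependent rC≡ = <⇒≱ (≤-reflexive (sym (trans rC≡ ∣C∣≡3)))
      (≤-trans (∈cl⁻ z∈) (≤-trans (r-∪⁅⁆ ⁅ x ⁆ y) (+-monoˡ-≤ 1 (r-⁅⁆≤1 x))))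
    injective : InjectiveOn M c C
    injective u v u∈ v∈ = members {P = λ u → c u ≡ c v → u ≡ v}
      (members {P = λ v → c x ≡ c v → x ≡ v} (λ _ → refl) (⊥-elim ∘ cx≢cy) (⊥-elim ∘ cx≢cz) v∈)
      (members {P = λ v → c y ≡ c v → y ≡ v} (⊥-elim ∘ cx≢cy ∘ sym) (λ _ → refl) (⊥-elim ∘ cy≢cz) v∈)
      (members {P = λ v → c z ≡ c v → z ≡ v} (⊥-elim ∘ cx≢cz ∘ sym) (⊥-elim ∘ cy≢cz ∘ sym) (λ _ → refl) v∈)
      u∈

  module _ (connected : IsConnected M) (modular : IsModular M) (2≤rank : 2 ≤ rank M) where
    open Projective M connected modular 2≤rank

    -- Colour `j` does not occur off the closure, so two colours there on a line through `x` would
    -- make a rainbow.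
    class-stabilizes : ∀ {j i x} → x ∈ class c j → Stabilizes ⟪ class c j ⟫ (λ z → c z ≡ i) x
    class-stabilizes {j} {i} {x} x∈ = x∈F , λ {u} {v} u∉ cu xuv →
      let v∉ = λ v∈ → u∉ (triangle-∈ cl-flat (flip xuv) x∈F v∈)
      in trans (decidable-stable (c v Finₚ.≟ c u) λ cv≢cu →
           triangle-colours xuv (off u∉ , cv≢cu ∘ sym , off v∉)) cu
      where
      x∈F : x ∈ ⟪ class c j ⟫
      x∈F = cl-extensive x∈
      off : ∀ {w} → w ∉ ⟪ class c j ⟫ → c x ≢ c w
      off w∉ cx≡cw = w∉ (cl-extensive (∈class c (trans (sym cx≡cw) (∈class⁻ c x∈))))

    cl-class-decomposer : ∀ e {y} → y ∉ ⟪ class c (c e) ⟫ → IsDecomposer M c ⟪ class c (c e) ⟫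
    cl-class-decomposer e {y} y∉F = cl-flat , (λ F≡⊤ → y∉F (subst (y ∈_) (sym F≡⊤) ∈⊤)) ,
      λ a _ x z x∈ z∈ → same (p─q⊆p _ F x∈) (∈─⁻ x∈) (p─q⊆p _ F z∈) (∈─⁻ z∈) (x ∥? z)
      where
      F : Subset n
      F = ⟪ class c (c e) ⟫
      e∈F : e ∈ F
      e∈F = cl-extensive (∈class c refl)
      stabilizes : ∀ {h u v} → h ∈ F → u ∉ F → Triangle h u v → c v ≡ c u
      stabilizes h∈F u∉F = proj₂ (cl⊆Stabilizes cl-flat class-stabilizes h∈F) u∉F refl
      same : ∀ {a x z} → x ∈ cover F a → x ∉ F → z ∈ cover F a → z ∉ F → Dec (x ∥ z) → c x ≡ c z
      same x∈ x∉F z∈ z∉F (no x∦z) =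
        let h , h∈F , xzh = meet cl-flat x∈ z∈ x∉F z∉F x∦z
        in sym (stabilizes h∈F x∉F (rotate (rotate xzh)))
      -- Parallel elements span no line; both are compared with a third point on their line to `e`.
      same x∈ x∉F z∈ z∉F (yes x∥z) =
        let g , exg = third λ e∥x → x∉F (∥-closed cl-flat e∈F e∥x)
        in trans (sym (stabilizes e∈F x∉F exg))
                 (stabilizes e∈F z∉F (swap (triangle-∥ x∥z (swap exg))))

    -- The colours of `p` and `q` are kept and all others merged. Merging creates no rainbow
    -- triangle, and each merged class contains an original one, so it still spans.
    not-all-spanning : ∀ {p q s} → c p ≢ c q → c p ≢ c s → c q ≢ c s →
      ¬ (∀ e x → x ∈ ⟪ class c (c e) ⟫)
    not-all-spanning {p} {q} {s} cp≢cq cp≢cs cq≢cs spanning =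
      ThreeColours.impossible M connected modular 2≤rank (merge ∘ c)
        (λ t (i≢j , j≢k , i≢k) → triangle-colours t (i≢j ∘ cong merge , j≢k ∘ cong merge , i≢k ∘ cong merge))
        (λ i flat class⊆G x → cl-least flat
          (λ y∈ → class⊆G (trans (cong merge (∈class⁻ c y∈)) (merge-representative i)))
          (spanning (representative i) x))
      where
      choose : ∀ {j} → Dec (j ≡ c p) → Dec (j ≡ c q) → Fin 3
      choose (yes _) _       = zero
      choose (no _)  (yes _) = suc zero
      choose (no _)  (no _)  = suc (suc zero)
      merge : Fin k → Fin 3
      merge j = choose (j Finₚ.≟ c p) (j Finₚ.≟ c q)
      representative : Fin 3 → Fin n
      representative zero             = p
      representative (suc zero)       = q
      representative (suc (suc zero)) = s
      choose-zero : ∀ d d′ → choose {c p} d d′ ≡ zero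
      choose-zero (yes _) _ = refl
      choose-zero (no ¬eq) _ = ⊥-elim (¬eq refl)
      choose-one : ∀ d d′ → choose {c q} d d′ ≡ suc zero
      choose-one (yes eq) _ = ⊥-elim (cp≢cq (sym eq))
      choose-one (no _) (yes _) = refl
      choose-one (no _) (no ¬eq) = ⊥-elim (¬eq refl)
      choose-two : ∀ d d′ → choose {c s} d d′ ≡ suc (suc zero)
      choose-two (yes eq) _ = ⊥-elim (cp≢cs (sym eq))
      choose-two (no _) (yes eq) = ⊥-elim (cq≢cs (sym eq))
      choose-two (no _) (no _) = refl
      merge-representative : ∀ i → merge (c (representative i)) ≡ i
      merge-representative zero             = choose-zero (c p Finₚ.≟ c p) (c p Finₚ.≟ c q)
      merge-representative (suc zero)       = choose-one (c q Finₚ.≟ c p) (c q Finₚ.≟ c q)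
      merge-representative (suc (suc zero)) = choose-two (c s Finₚ.≟ c p) (c s Finₚ.≟ c q)

theorem5p9 : {n k : ℕ} (M : Matroid n) (c : Fin n → Fin k) →
    IsConnected M → IsModular M → NoRainbowTriangle M c →
    2 ≤ rank M → 3 ≤ numColours M c →
    ∃ λ F → Nonempty F × IsDecomposer M c F
theorem5p9 {n} M c connected modular no-rainbow 2≤rank 3≤colours =
  let j₁ , j₂ , j₃ , (j₁∈ , j₂∈ , j₃∈) , (j₁≢j₂ , j₁≢j₃ , j₂≢j₃) = three-members {p = usedColours M c} 3≤colours
      p , cp = used j₁∈
      q , cq = used j₂∈
      s , cs = used j₃∈
      not-all = not-all-spanning M c no-rainbow connected modular 2≤rank
        (distinct cp cq j₁≢j₂) (distinct cp cs j₁≢j₃) (distinct cq cs j₂≢j₃)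
      -- Membership in each `F e` is decidable, so a finite search turns the negation into a
      -- witness.
      e , e-proper = Finₚ.¬∀⟶∃¬ n (λ e → ∀ x → x ∈ F e) (λ e → Finₚ.all? (_∈? F e)) not-all
      y , y∉F = Finₚ.¬∀⟶∃¬ n (_∈ F e) (_∈? F e) e-proper
  in F e , (e , Closure.cl-extensive M (∈class c refl)) ,
     cl-class-decomposer M c no-rainbow connected modular 2≤rank e y∉F
  where
  F : Fin n → Subset n
  F e = cl M (class c (c e))
  used : ∀ {j} → j ∈ usedColours M c → ∃ λ e → c e ≡ j
  used = ∈-tabulate⁻ (λ j → Finₚ.any? (λ e → c e Finₚ.≟ j))
  distinct : ∀ {x y i j} → c x ≡ i → c y ≡ j → i ≢ j → c x ≢ c y
  distinct refl refl i≢j = i≢j
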